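{- Let $l\geq 0$ be an integer. Then $f_2(8l+i)=6l+i$ for every $i$ with $0\leq i\leq 5$, and $f_2(8l+6)=f_2(8l+7)=6l+5$.
   Context: $\Sigma_k=\{0,1,\ldots,k-1\}$. A border of a word $w$ is a non-empty word that is both a proper prefix and a proper suffix of $w$; $w$ is unbordered if it has no border. A border $u$ of $w$ is non-overlapping if $|u|\le |w|/2$. The smallest BP-factorization of a word $w$ is the factorization $w=w_m\cdots w_1w_0w_1\cdots w_m$ ($m\ge 0$) in which, for each $i\ge 1$, $w_i$ is the longest non-overlapping border of $w_i\cdots w_1w_0w_1\cdots w_i$, and $w_0$ is either empty or unbordered (i.e., one repeatedly removes the longest non-overlapping border from both ends until an empty or unbordered central word remains). Its width is $2m+1$ if $w_0$ is non-empty and $2m$ if $w_0$ is empty. $f_k(n)$ denotes the maximum width of the smallest BP-factorization over all length-$n$ words over $\Sigma_k$. -}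

module Defs where

open import Data.Empty using (⊥-elim)
open import Data.Fin using (Fin)
import Data.Fin.Properties as Fin
open import Data.List using (List; []; _∷_; _++_; length; take; map; allFin; cartesianProductWith)
open import Data.List.Extrema.Nat using (max)
open import Data.List.Membership.Propositional using (_∈_)
open import Data.List.Membership.Propositional.Properties
  using (∈-allFin; ∈-cartesianProductWith⁺; ∈-cartesianProductWith⁻)
open import Data.List.Properties
  using (≡-dec; length-++; ++-assoc; ++-identityʳ; ++-cancelˡ; ++-cancelʳ; ∷-injective)
open import Data.List.Relation.Binary.Pointwise using (≡⇒Pointwise-≡; Pointwise-≡⇒≡)
open import Data.List.Relation.Binary.Prefix.Heterogeneous as Prefix using (Prefix)
open import Data.List.Relation.Binary.Prefix.Heterogeneous.Properties using (prefix?)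
open import Data.List.Relation.Binary.Suffix.Heterogeneous as Suffix using (Suffix)
open import Data.List.Relation.Binary.Suffix.Heterogeneous.Properties using (suffix?)
open import Data.List.Relation.Unary.Any using (here)
open import Data.Nat using (ℕ; zero; suc; _+_; _*_; _≤_; _<_; z≤n; s≤s; _≤?_)
open import Data.Nat.Induction using (<-wellFounded)
open import Data.Nat.Properties
open import Data.Product using (∃; _×_; _,_; proj₁; proj₂)
open import Data.Sum using (_⊎_; inj₁; inj₂)
open import Data.Unit using (⊤; tt)
open import Induction.WellFounded using (Acc; acc)
open import Relation.Binary.PropositionalEquality
open import Relation.Nullary using (¬_; Dec; yes; no; ¬?; _×-dec_)

Word : ℕ → Set
Word k = List (Fin k)

private
  variable
    k : ℕ

infix 4 _≟ʷ_

_≟ʷ_ : (u v : Word k) → Dec (u ≡ v)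
_≟ʷ_ = ≡-dec Fin._≟_

ProperPrefix ProperSuffix : Word k → Word k → Set
ProperPrefix u w = Prefix _≡_ u w × u ≢ w
ProperSuffix u w = Suffix _≡_ u w × u ≢ w

Border : Word k → Word k → Set
Border u w = u ≢ [] × ProperPrefix u w × ProperSuffix u w

-- The empty word is unbordered under this definition.
Unbordered : Word k → Set
Unbordered w = ∀ u → ¬ Border u w

NonOverlappingBorder : Word k → Word k → Set
NonOverlappingBorder u w = Border u w × 2 * length u ≤ length w

LongestNonOverlappingBorder : Word k → Word k → Set
LongestNonOverlappingBorder u w =
  NonOverlappingBorder u w × (∀ v → NonOverlappingBorder v w → length v ≤ length u)

-- The outer factors are listed from the outside in:
-- assemble (wₘ ∷ … ∷ w₁ ∷ []) w₀ = wₘ ⋯ w₁ w₀ w₁ ⋯ wₘ.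
assemble : List (Word k) → Word k → Word k
assemble []       c = c
assemble (u ∷ us) c = u ++ assemble us c ++ u

AllLongest : List (Word k) → Word k → Set
AllLongest []       c = ⊤
AllLongest (u ∷ us) c =
  LongestNonOverlappingBorder u (assemble (u ∷ us) c) × AllLongest us c

record SmallestBPFactorization (w : Word k) : Set where
  field
    outer         : List (Word k)
    centre        : Word k
    factors       : assemble outer centre ≡ w
    longest       : AllLongest outer centre
    centre-simple : centre ≡ [] ⊎ Unbordered centre

open SmallestBPFactorization public

centreWidth : Word k → ℕ
centreWidth []      = 0
centreWidth (_ ∷ _) = 1

factorizationWidth : {w : Word k} → SmallestBPFactorization w → ℕ
factorizationWidth F = 2 * length (outer F) + centreWidth (centre F)

prefix⇒ : {u w : Word k} → Prefix _≡_ u w → ∃ λ a → w ≡ u ++ a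
prefix⇒ Prefix.[]          = _ , refl
prefix⇒ (refl Prefix.∷ p) with prefix⇒ p
... | a , refl = a , refl

prefix⇐ : (u a : Word k) → Prefix _≡_ u (u ++ a)
prefix⇐ []      a = Prefix.[]
prefix⇐ (x ∷ u) a = refl Prefix.∷ prefix⇐ u a

suffix⇒ : {u w : Word k} → Suffix _≡_ u w → ∃ λ b → w ≡ b ++ u
suffix⇒ (Suffix.here eq)   = [] , sym (Pointwise-≡⇒≡ eq)
suffix⇒ (Suffix.there {b = x} s) with suffix⇒ s
... | b , refl = x ∷ b , refl

suffix⇐ : (b u : Word k) → Suffix _≡_ u (b ++ u)
suffix⇐ []      u = Suffix.here (≡⇒Pointwise-≡ refl)
suffix⇐ (x ∷ b) u = Suffix.there (suffix⇐ b u)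

border? : (u w : Word k) → Dec (Border u w)
border? u w =
  ¬? (u ≟ʷ []) ×-dec
  (prefix? Fin._≟_ u w ×-dec ¬? (u ≟ʷ w)) ×-dec
  (suffix? Fin._≟_ u w ×-dec ¬? (u ≟ʷ w))

nonOverlappingBorder? : (u w : Word k) → Dec (NonOverlappingBorder u w)
nonOverlappingBorder? u w = border? u w ×-dec (2 * length u ≤? length w)

split : (b : Word k) {u a c : Word k} → u ++ a ≡ b ++ c → length b ≤ length u →
        ∃ λ d → u ≡ b ++ d × d ++ a ≡ c
split []      {u}     eq le = u , refl , eq
split (x ∷ b) {y ∷ u} eq (s≤s le) with ∷-injective eq
... | refl , eq′ with split b {u} eq′ le
... | d , refl , eq″ = d , refl , eq″

take-++ˡ : (u a : Word k) → take (length u) (u ++ a) ≡ u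
take-++ˡ []      a = refl
take-++ˡ (x ∷ u) a = cong (x ∷_) (take-++ˡ u a)

border-≡-take : {u w : Word k} → Border u w → u ≡ take (length u) w
border-≡-take {u = u} (_ , (p , _) , _) with prefix⇒ p
... | a , refl = sym (take-++ˡ u a)

border-length : {u w : Word k} → Border u w → length u < length w
border-length {u = u} (_ , (p , u≢w) , _) with prefix⇒ p
... | []    , refl = ⊥-elim (u≢w (sym (++-identityʳ u)))
... | x ∷ a , refl rewrite length-++ u {x ∷ a} = m<m+n (length u) (s≤s z≤n)

nonempty-length : {u : Word k} → u ≢ [] → 0 < length u
nonempty-length {u = []}    u≢[] = ⊥-elim (u≢[] refl)
nonempty-length {u = _ ∷ _} _    = s≤s z≤n

shorter⇒≢ : {u w : Word k} → length u < length w → u ≢ w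
shorter⇒≢ lt refl = <-irrefl refl lt

nonOverlapping-split : {u w : Word k} → NonOverlappingBorder u w → ∃ λ m → w ≡ u ++ m ++ u
nonOverlapping-split {u = u} ((_ , (p , _) , (s , _)) , le) with prefix⇒ p
... | a , refl with suffix⇒ s
... | b , eq with split u {b} (sym eq) u≤b
  where
  open ≤-Reasoning
  u≤b : length u ≤ length b
  u≤b = +-cancelʳ-≤ (length u) (length u) (length b) (begin
    length u + length u ≡⟨ cong (length u +_) (sym (+-identityʳ _)) ⟩
    2 * length u        ≤⟨ le ⟩
    length (u ++ a)     ≡⟨ cong length eq ⟩
    length (b ++ u)     ≡⟨ length-++ b ⟩
    length b + length u ∎)
... | d , _ , refl = d , refl

-- A border longer than half the word overlaps itself in a shorter border.
overlap-border : {u w : Word k} → Border u w → length w < 2 * length u →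
                 ∃ λ v → Border v w × length v < length u
overlap-border {u = u} {w} B@(_ , (p , _) , (s , _)) lt with prefix⇒ p
... | a , w≡ua with suffix⇒ s
... | b , w≡bu with split b {u} (trans (sym w≡ua) w≡bu) (<⇒≤ b<u)
  where
  open ≤-Reasoning
  b<u : length b < length u
  b<u = +-cancelʳ-< (length u) (length b) (length u) (begin-strict
    length b + length u ≡⟨ length-++ b ⟨
    length (b ++ u)     ≡⟨ cong length w≡bu ⟨
    length w            <⟨ lt ⟩
    2 * length u        ≡⟨ cong (length u +_) (+-identityʳ _) ⟩
    length u + length u ∎)
... | c , u≡bc , ca≡u = c , (c≢[] , (pc , c≢w) , (sc , c≢w)) , c<u
  where
  b≢[] : b ≢ []
  b≢[] refl = <-irrefl (cong length (sym w≡bu)) (border-length B)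
  c<u : length c < length u
  c<u = subst (length c <_) (trans (sym (length-++ b)) (cong length (sym u≡bc)))
          (m<n+m (length c) (nonempty-length b≢[]))
  c≢w : c ≢ w
  c≢w = shorter⇒≢ (<-trans c<u (border-length B))
  c≢[] : c ≢ []
  c≢[] refl = <⇒≱ lt (≤-reflexive (begin
      2 * length u        ≡⟨ cong (length u +_) (+-identityʳ _) ⟩
      length u + length u ≡⟨ cong (λ v → length v + length u) (trans u≡bc (++-identityʳ b)) ⟩
      length b + length u ≡⟨ length-++ b ⟨
      length (b ++ u)     ≡⟨ cong length w≡bu ⟨
      length w            ∎))
    where open ≡-Reasoning
  pc : Prefix _≡_ c w
  pc = subst (Prefix _≡_ c)
         (trans (sym (++-assoc c a a)) (trans (cong (_++ a) ca≡u) (sym w≡ua)))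
         (prefix⇐ c (a ++ a))
  sc : Suffix _≡_ c w
  sc = subst (Suffix _≡_ c)
         (trans (++-assoc b b c) (trans (cong (b ++_) (sym u≡bc)) (sym w≡bu)))
         (suffix⇐ (b ++ b) c)

bordered⇒nonOverlapping : {u w : Word k} → Border u w → ∃ λ v → NonOverlappingBorder v w
bordered⇒nonOverlapping {k} {w = w} = go (<-wellFounded _)
  where
  go : {u : Word k} → Acc _<_ (length u) → Border u w → ∃ λ v → NonOverlappingBorder v w
  go {u} (acc rs) B with 2 * length u ≤? length w
  ... | yes le = u , B , le
  ... | no ¬le with overlap-border B (≰⇒> ¬le)
  ... | v , B′ , lt = go (rs lt) B′

longest? : (w : Word k) → ∃ (λ u → LongestNonOverlappingBorder u w) ⊎ Unbordered w
longest? {k} w with go (length w)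
  where
  go : ∀ n → (∃ λ u → NonOverlappingBorder u w ×
                 (∀ v → NonOverlappingBorder v w → length v ≤ n → length v ≤ length u))
           ⊎ (∀ v → NonOverlappingBorder v w → ¬ length v ≤ n)
  go zero = inj₂ λ v N le → <⇒≱ (nonempty-length (proj₁ (proj₁ N))) le
  go (suc n) with nonOverlappingBorder? (take (suc n) w) w
  ... | yes N = inj₁ (take (suc n) w , N , longest′)
    where
    longest′ : ∀ v → NonOverlappingBorder v w → length v ≤ suc n →
               length v ≤ length (take (suc n) w)
    longest′ v (B , _) le with prefix⇒ (proj₁ (proj₁ (proj₂ B)))
    ... | a , refl = take-≥ (suc n) v a le
      where
      take-≥ : ∀ n (v a : Word k) → length v ≤ n → length v ≤ length (take n (v ++ a))
      take-≥ n       []      a le       = z≤n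
      take-≥ (suc n) (x ∷ v) a (s≤s le) = s≤s (take-≥ n v a le)
  ... | no ¬N with go n
  ...   | inj₁ (u , N , long) = inj₁ (u , N , long′)
    where
    long′ : ∀ v → NonOverlappingBorder v w → length v ≤ suc n → length v ≤ length u
    long′ v M le with m≤n⇒m<n∨m≡n le
    ... | inj₁ (s≤s le′) = long v M le′
    ... | inj₂ eq = ⊥-elim (¬N (subst (λ x → NonOverlappingBorder x w)
                      (trans (border-≡-take (proj₁ M)) (cong (λ i → take i w) eq)) M))
  ...   | inj₂ none = inj₂ none′
    where
    none′ : ∀ v → NonOverlappingBorder v w → ¬ length v ≤ suc n
    none′ v M le with m≤n⇒m<n∨m≡n le
    ... | inj₁ (s≤s le′) = none v M le′
    ... | inj₂ eq = ¬N (subst (λ x → NonOverlappingBorder x w)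
                      (trans (border-≡-take (proj₁ M)) (cong (λ i → take i w) eq)) M)
... | inj₁ (u , N , long) =
        inj₁ (u , N , λ v M → long v M (<⇒≤ (border-length (proj₁ M))))
... | inj₂ none = inj₂ λ u B → let v , M = bordered⇒nonOverlapping B in
        none v M (<⇒≤ (border-length (proj₁ M)))

middle-shorter : {u : Word k} (m : Word k) → u ≢ [] → length m < length (u ++ m ++ u)
middle-shorter {u = u} m u≢[] = begin-strict
  length m                          <⟨ m<n+m (length m) (nonempty-length u≢[]) ⟩
  length u + length m               ≤⟨ +-monoʳ-≤ (length u) (m≤m+n _ _) ⟩
  length u + (length m + length u)  ≡⟨ cong (length u +_) (length-++ m) ⟨
  length u + length (m ++ u)        ≡⟨ length-++ u ⟨
  length (u ++ m ++ u)              ∎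
  where open ≤-Reasoning

peel : {u m : Word k} → LongestNonOverlappingBorder u (u ++ m ++ u) →
       SmallestBPFactorization m → SmallestBPFactorization (u ++ m ++ u)
peel {u = u} L F = record
  { outer         = u ∷ outer F
  ; centre        = centre F
  ; factors       = cong (λ x → u ++ x ++ u) (factors F)
  ; longest       = subst (λ x → LongestNonOverlappingBorder u (u ++ x ++ u)) (sym (factors F)) L
                  , longest F
  ; centre-simple = centre-simple F
  }

smallestBP-acc : (w : Word k) → Acc _<_ (length w) → SmallestBPFactorization w
smallestBP-acc w (acc rs) with longest? w
... | inj₂ unb = record
  { outer = [] ; centre = w ; factors = refl ; longest = tt ; centre-simple = inj₂ unb }
... | inj₁ (u , L) with nonOverlapping-split (proj₁ L)
... | m , refl =
  peel L (smallestBP-acc m (rs (middle-shorter m (proj₁ (proj₁ (proj₁ L))))))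

smallestBP : (w : Word k) → SmallestBPFactorization w
smallestBP w = smallestBP-acc w (<-wellFounded (length w))

longest-unique : {u v w : Word k} →
  LongestNonOverlappingBorder u w → LongestNonOverlappingBorder v w → u ≡ v
longest-unique {u = u} {v} {w} (M , long) (N , long′) = begin
  u                 ≡⟨ border-≡-take (proj₁ M) ⟩
  take (length u) w ≡⟨ cong (λ i → take i w) (≤-antisym (long′ u M) (long v N)) ⟩
  take (length v) w ≡⟨ border-≡-take (proj₁ N) ⟨
  v                 ∎
  where open ≡-Reasoning

simple⇒unbordered : {c : Word k} → c ≡ [] ⊎ Unbordered c → Unbordered c
simple⇒unbordered (inj₁ refl) u B with border-length B
... | ()
simple⇒unbordered (inj₂ unb)      = unb

smallestBP-unique : {w : Word k} (F G : SmallestBPFactorization w) →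
                    outer F ≡ outer G × centre F ≡ centre G
smallestBP-unique {k} F G =
  go (outer F) (outer G) (trans (factors F) (sym (factors G)))
     (longest F) (longest G) (centre-simple F) (centre-simple G)
  where
  go : ∀ us vs {c d : Word k} → assemble us c ≡ assemble vs d →
       AllLongest us c → AllLongest vs d →
       c ≡ [] ⊎ Unbordered c → d ≡ [] ⊎ Unbordered d → us ≡ vs × c ≡ d
  go []       []       eq _ _ _ _ = refl , eq
  go []       (v ∷ vs) refl _ (((B , _) , _) , _) cs _ =
    ⊥-elim (simple⇒unbordered cs v B)
  go (u ∷ us) []       refl (((B , _) , _) , _) _ _ ds =
    ⊥-elim (simple⇒unbordered ds u B)
  go (u ∷ us) (v ∷ vs) {c} {d} eq (L , Ls) (M , Ms) cs ds
    with longest-unique L (subst (LongestNonOverlappingBorder v) (sym eq) M)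
  ... | refl with go us vs (++-cancelʳ u _ _ (++-cancelˡ u _ _ eq)) Ls Ms cs ds
  ... | refl , refl = refl , refl

width : Word k → ℕ
width w = factorizationWidth (smallestBP w)

width-unique : {w : Word k} (F : SmallestBPFactorization w) → factorizationWidth F ≡ width w
width-unique {w = w} F =
  let us≡ , c≡ = smallestBP-unique F (smallestBP w) in
  cong₂ (λ us c → 2 * length us + centreWidth c) us≡ c≡

words : (k n : ℕ) → List (Word k)
words k zero    = [] ∷ []
words k (suc n) = cartesianProductWith _∷_ (allFin k) (words k n)

∈-words⁺ : (w : Word k) → w ∈ words k (length w)
∈-words⁺ []      = here refl
∈-words⁺ (x ∷ w) = ∈-cartesianProductWith⁺ _∷_ (∈-allFin x) (∈-words⁺ w)

∈-words⁻ : ∀ n {w : Word k} → w ∈ words k n → length w ≡ n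
∈-words⁻ zero    (here refl) = refl
∈-words⁻ {k} (suc n) w∈ with ∈-cartesianProductWith⁻ _∷_ (allFin k) (words k n) w∈
... | _ , _ , _ , v∈ , refl = cong suc (∈-words⁻ n v∈)

-- The base value 0 only matters when there are no words (k = 0 and n > 0).
f : (k n : ℕ) → ℕ
f k n = max 0 (map width (words k n))

{-# OPTIONS --safe #-}

-- Write m(n) for the claimed value, so m(8l+i) = 6l + m(i).
-- Upper bound: three consecutive outer factors a, b, d of length one are impossible.  In the word
-- a b d ⋯ d b a either a = b and aa is a longer border, or b = d and bb is a longer border of the word
-- inside, or (the alphabet being binary) a = d and aba is a longer border.  So every three factors cost
-- at least four letters per side.
-- Lower bound: (0101)^l c (0110)^l, for a suitable centre c with |c| = i.  Its outer factors
-- are 0, 1, 01 periodically, because neither 0101 nor 1010 occurs in the right half, which leaves only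
-- borders of length at most three.
module Submission where

open import Defs
open import Data.Empty using (⊥-elim)
open import Data.Fin using (Fin; zero; suc)
import Data.Fin.Properties as Fin
open import Data.List using (List; []; _∷_; [_]; _++_; length)
open import Data.List.Extrema.Nat using (max≤v⁺; v≤max⁺)
open import Data.List.Membership.Propositional.Properties using (∈-map⁺)
open import Data.List.Properties using (length-++; ++-assoc; ++-identityʳ)
open import Data.List.Relation.Binary.Infix.Heterogeneous using (Infix; here; there; MkView; fromView; _ⁱ++_)
open import Data.List.Relation.Binary.Infix.Heterogeneous.Properties using (infix?)
open import Data.List.Relation.Binary.Pointwise using (≡⇒Pointwise-≡)
open import Data.List.Relation.Binary.Prefix.Heterogeneous using (Prefix; []; _∷_)
open import Data.List.Relation.Binary.Suffix.Heterogeneous using (Suffix)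
open import Data.List.Relation.Binary.Suffix.Heterogeneous.Properties using (suffix?)
open import Data.List.Relation.Unary.All using (tabulate)
import Data.List.Relation.Unary.All.Properties as All
import Data.List.Relation.Unary.Any as Any
open import Data.Nat using (ℕ; zero; suc; _+_; _*_; _≤_; _<_; z≤n; s≤s; _≤?_)
open import Data.Nat.Properties
open import Data.Nat.Tactic.RingSolver using (solve-∀)
open import Data.Product using (_×_; _,_)
open import Data.Sum using (_⊎_; inj₁; inj₂)
import Data.Sum as Sum
open import Relation.Binary.PropositionalEquality hiding ([_])
open import Relation.Nullary using (¬_; yes; no; contradiction)
open import Relation.Nullary.Decidable using (True; False; toWitness; toWitnessFalse)

private
  variable
    k : ℕ

-- Words of the form `u ++ x ++ u`

length-flank : (u x : Word k) → length (u ++ x ++ u) ≡ 2 * length u + length x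
length-flank u x = begin
  length (u ++ x ++ u)             ≡⟨ length-++ u ⟩
  length u + length (x ++ u)       ≡⟨ cong (length u +_) (length-++ x) ⟩
  length u + (length x + length u) ≡⟨ lemma (length u) (length x) ⟩
  2 * length u + length x          ∎
  where
  open ≡-Reasoning
  lemma : ∀ a b → a + (b + a) ≡ 2 * a + b
  lemma = solve-∀

-- Converse of `nonOverlapping-split`: the two copies of `u` are disjoint by construction, so the
-- length condition is automatic.
flank-border : {u : Word k} (x : Word k) → u ≢ [] → NonOverlappingBorder u (u ++ x ++ u)
flank-border {u = u} x u≢[] =
  (u≢[] , (prefix⇐ u (x ++ u) , u≢w)
        , (subst (Suffix _≡_ u) (++-assoc u x u) (suffix⇐ (u ++ x) u) , u≢w))
  , (begin
      2 * length u            ≤⟨ m≤m+n _ _ ⟩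
      2 * length u + length x ≡⟨ length-flank u x ⟨
      length (u ++ x ++ u)    ∎)
  where
  open ≤-Reasoning
  u≢w : u ≢ u ++ x ++ u
  u≢w = shorter⇒≢ (begin-strict
    length u                     <⟨ m<m+n (length u) (nonempty-length u≢[]) ⟩
    length u + length u          ≤⟨ +-monoʳ-≤ (length u) (m≤n+m (length u) (length x)) ⟩
    length u + (length x + length u) ≡⟨ cong (length u +_) (length-++ x) ⟨
    length u + length (x ++ u)   ≡⟨ length-++ u ⟨
    length (u ++ x ++ u)         ∎)

-- The upper bound

-- A recursion of period eight instead of division: an inequality between values at `n` and `n` plus
-- a constant reduces to eight closed cases.
maxWidth : ℕ → ℕ
maxWidth 0 = 0
maxWidth 1 = 1
maxWidth 2 = 2
maxWidth 3 = 3
maxWidth 4 = 4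
maxWidth 5 = 5
maxWidth 6 = 5
maxWidth 7 = 5
maxWidth (suc (suc (suc (suc (suc (suc (suc (suc n)))))))) = 6 + maxWidth n

maxWidth-suc : ∀ n → maxWidth n ≤ maxWidth (suc n)
maxWidth-suc 0 = n≤1+n _
maxWidth-suc 1 = n≤1+n _
maxWidth-suc 2 = n≤1+n _
maxWidth-suc 3 = n≤1+n _
maxWidth-suc 4 = n≤1+n _
maxWidth-suc 5 = ≤-refl
maxWidth-suc 6 = ≤-refl
maxWidth-suc 7 = n≤1+n _
maxWidth-suc (suc (suc (suc (suc (suc (suc (suc (suc n)))))))) = +-monoʳ-≤ 6 (maxWidth-suc n)

maxWidth-mono : ∀ {m n} → m ≤ n → maxWidth m ≤ maxWidth n
maxWidth-mono {m} le with m≤n⇒∃[o]m+o≡n le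
... | o , refl = go o
  where
  go : ∀ o → maxWidth m ≤ maxWidth (m + o)
  go zero    = ≤-reflexive (cong maxWidth (sym (+-identityʳ m)))
  go (suc o) = ≤-trans (go o) (≤-trans (maxWidth-suc (m + o))
                 (≤-reflexive (cong maxWidth (sym (+-suc m o)))))

-- The price of a factor with at least two letters: two units of width for at least four letters.
2+maxWidth : ∀ n → 2 + maxWidth n ≤ maxWidth (4 + n)
2+maxWidth 0 = m≤n+m _ 2
2+maxWidth 1 = m≤n+m _ 2
2+maxWidth 2 = m≤n+m _ 1
2+maxWidth 3 = ≤-refl
2+maxWidth 4 = ≤-refl
2+maxWidth 5 = ≤-refl
2+maxWidth 6 = m≤n+m _ 1
2+maxWidth 7 = m≤n+m _ 2
2+maxWidth (suc (suc (suc (suc (suc (suc (suc (suc n)))))))) = +-monoʳ-≤ 6 (2+maxWidth n)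

-- The same for one single letter followed by a longer factor: four units of width for at least six
-- letters.
4+maxWidth : ∀ n → 4 + maxWidth n ≤ maxWidth (6 + n)
4+maxWidth 0 = m≤n+m _ 1
4+maxWidth 1 = ≤-refl
4+maxWidth 2 = ≤-refl
4+maxWidth 3 = ≤-refl
4+maxWidth 4 = ≤-refl
4+maxWidth 5 = ≤-refl
4+maxWidth 6 = m≤n+m _ 1
4+maxWidth 7 = m≤n+m _ 2
4+maxWidth (suc (suc (suc (suc (suc (suc (suc (suc n)))))))) = +-monoʳ-≤ 6 (4+maxWidth n)

-- No three single letters in a row

-- Otherwise `v` would be a non-overlapping border longer than `u`; it is non-empty because it is
-- longer than `u`.
longest⇒¬flank : {u w : Word k} (v x : Word k) → LongestNonOverlappingBorder u w →
                 length u < length v → w ≢ v ++ x ++ v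
longest⇒¬flank v x (_ , long) u<v refl =
  <⇒≱ u<v (long v (flank-border x λ where refl → contradiction u<v λ ()))

coincidence : (a b c : Fin 2) → a ≡ b ⊎ b ≡ c ⊎ a ≡ c
coincidence a b c with a Fin.≟ b | b Fin.≟ c | a Fin.≟ c
... | yes p | _     | _     = inj₁ p
... | no _  | yes p | _     = inj₂ (inj₁ p)
... | no _  | no _  | yes p = inj₂ (inj₂ p)
coincidence zero       zero       _          | no p | _ | _ = contradiction refl p
coincidence zero       (suc zero) zero       | _ | _ | no p = contradiction refl p
coincidence zero       (suc zero) (suc zero) | _ | no p | _ = contradiction refl p
coincidence (suc zero) zero       zero       | _ | no p | _ = contradiction refl p
coincidence (suc zero) zero       (suc zero) | _ | _ | no p = contradiction refl p
coincidence (suc zero) (suc zero) _          | no p | _ | _ = contradiction refl p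

¬three-letters : (a b d : Fin 2) {us : List (Word 2)} {c : Word 2} →
                 ¬ AllLongest ([ a ] ∷ [ b ] ∷ [ d ] ∷ us) c
¬three-letters a b d {us} {c} (La , Lb , _) with coincidence a b d
-- The word reads `a b d x d b a`. For `a ≡ b` the part between the two copies of `aa` is `d x d`;
-- in the other two cases it is `x`.
... | inj₁ refl        = longest⇒¬flank (a ∷ a ∷ []) (d ∷ x ++ [ d ]) La ≤-refl
        (cong (λ y → a ∷ a ∷ y) (++-assoc (d ∷ x ++ [ d ]) [ a ] [ a ]))
  where x = assemble us c
... | inj₂ (inj₁ refl) = longest⇒¬flank (b ∷ b ∷ []) x Lb ≤-refl
        (cong (λ y → b ∷ b ∷ y) (++-assoc x [ b ] [ b ]))
  where x = assemble us c
... | inj₂ (inj₂ refl) = longest⇒¬flank (a ∷ b ∷ a ∷ []) x La (s≤s (s≤s z≤n))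
        (cong (λ y → a ∷ b ∷ a ∷ y) (trans
          (cong (_++ [ a ]) (++-assoc x [ a ] [ b ]))
          (++-assoc x (a ∷ b ∷ []) [ a ])))
  where x = assemble us c

-- Induction over the outer factors

factorCount : List (Word k) → Word k → ℕ
factorCount us c = 2 * length us + centreWidth c

factorCount-∷ : (u : Word k) (us : List (Word k)) (c : Word k) →
                factorCount (u ∷ us) c ≡ 2 + factorCount us c
factorCount-∷ u us c = lemma (length us) (centreWidth c)
  where
  lemma : ∀ m n → 2 * suc m + n ≡ 2 + (2 * m + n)
  lemma = solve-∀

-- End of the induction. Here `n` is both the number of letters in the single-letter factors around
-- the centre and their contribution to the width.
centre-bound : (c : Word k) (n : ℕ) → (∀ m → n + 1 ≤ maxWidth (n + suc m)) → n ≤ maxWidth n →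
               n + centreWidth c ≤ maxWidth (n + length c)
centre-bound []      n _ p rewrite +-identityʳ n = p
centre-bound (_ ∷ c) n h _ = h (length c)

length-flank-letter : (a : Fin k) (w : Word k) → length (a ∷ w ++ [ a ]) ≡ 2 + length w
length-flank-letter a w = length-flank [ a ] w

-- Each round consumes the leading single letters, at most two of them, together with the next
-- longer factor or the centre.
factorCount-≤ : (us : List (Word 2)) (c : Word 2) → AllLongest us c →
                factorCount us c ≤ maxWidth (length (assemble us c))

-- The n letters of the length-one factors outside u add n to the width as well as to the length.
long-factor : (n : ℕ) (u : Word 2) (us : List (Word 2)) (c : Word 2) → AllLongest us c → 2 ≤ length u →
              (∀ m → n + (2 + maxWidth m) ≤ maxWidth (n + (4 + m))) →
              n + factorCount (u ∷ us) c ≤ maxWidth (n + length (assemble (u ∷ us) c))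
long-factor n u us c Ls 2≤u h = begin
  n + factorCount (u ∷ us) c                    ≡⟨ cong (n +_) (factorCount-∷ u us c) ⟩
  n + (2 + factorCount us c)                    ≤⟨ +-monoʳ-≤ n (+-monoʳ-≤ 2 (factorCount-≤ us c Ls)) ⟩
  n + (2 + maxWidth (length w))                 ≤⟨ h (length w) ⟩
  -- A factor of more than two letters costs more length for the same gain, so monotonicity
  -- suffices.
  maxWidth (n + (4 + length w))                 ≤⟨ maxWidth-mono (+-monoʳ-≤ n
                                                     (+-monoˡ-≤ (length w) (*-monoʳ-≤ 2 2≤u))) ⟩
  maxWidth (n + (2 * length u + length w))      ≡⟨ cong (λ m → maxWidth (n + m)) (length-flank u w) ⟨
  maxWidth (n + length (assemble (u ∷ us) c))   ∎
  where
  open ≤-Reasoning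
  w = assemble us c

factorCount-≤ [] c _ = centre-bound c 0 (λ m → maxWidth-mono (m≤m+n 1 m)) z≤n
factorCount-≤ ([] ∷ us) c ((((u≢[] , _) , _) , _) , _) = contradiction refl u≢[]
factorCount-≤ (u@(_ ∷ _ ∷ _) ∷ us) c (_ , Ls) =
  long-factor 0 u us c Ls (s≤s (s≤s z≤n)) 2+maxWidth
factorCount-≤ ((a ∷ []) ∷ []) c _ rewrite length-flank-letter a c =
  centre-bound c 2 (λ m → maxWidth-mono (m≤m+n 3 m)) ≤-refl
factorCount-≤ ((a ∷ []) ∷ [] ∷ us) c (_ , (((u≢[] , _) , _) , _) , _) = contradiction refl u≢[]
factorCount-≤ ((a ∷ []) ∷ v@(_ ∷ _ ∷ _) ∷ us) c (_ , _ , Ls)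
  rewrite factorCount-∷ [ a ] (v ∷ us) c | length-flank-letter a (assemble (v ∷ us) c) =
  long-factor 2 v us c Ls (s≤s (s≤s z≤n)) 4+maxWidth
factorCount-≤ ((a ∷ []) ∷ (b ∷ []) ∷ []) c _
  rewrite length-flank-letter a (b ∷ c ++ [ b ]) | length-flank-letter b c =
  centre-bound c 4 (λ m → maxWidth-mono (m≤m+n 5 m)) ≤-refl
factorCount-≤ ((a ∷ []) ∷ (b ∷ []) ∷ [] ∷ us) c (_ , _ , (((u≢[] , _) , _) , _) , _) =
  contradiction refl u≢[]
factorCount-≤ ((a ∷ []) ∷ (b ∷ []) ∷ v@(_ ∷ _ ∷ _) ∷ us) c (_ , _ , _ , Ls)
  rewrite factorCount-∷ [ a ] ([ b ] ∷ v ∷ us) c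
        | factorCount-∷ [ b ] (v ∷ us) c
        | length-flank-letter a (b ∷ assemble (v ∷ us) c ++ [ b ])
        | length-flank-letter b (assemble (v ∷ us) c) =
  -- Six units of width for eight letters is exactly the recursion of `maxWidth`, so both sides
  -- agree by computation.
  long-factor 4 v us c Ls (s≤s (s≤s z≤n)) (λ m → ≤-refl)
factorCount-≤ ((a ∷ []) ∷ (b ∷ []) ∷ (d ∷ []) ∷ us) c Ls =
  ⊥-elim (¬three-letters a b d Ls)

width≤maxWidth : (w : Word 2) → width w ≤ maxWidth (length w)
width≤maxWidth w with smallestBP w
... | record { outer = us ; centre = c ; factors = refl ; longest = Ls } = factorCount-≤ us c Ls

-- The lower bound

-- On a word with variable parts the search behind `width` does not reduce; uniqueness of the
-- factorization allows any factorization to be used instead.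
width-peel : {u x : Word k} → LongestNonOverlappingBorder u (u ++ x ++ u) →
             width (u ++ x ++ u) ≡ 2 + width x
width-peel {u = u} {x} L =
  trans (sym (width-unique (peel L F))) (factorCount-∷ u (outer F) (centre F))
  where F = smallestBP x

-- Occurrences of short words, and the borders they exclude

prefix-of-prefix : {p v w : Word k} → Prefix _≡_ p w → Prefix _≡_ v w → length p ≤ length v →
                   Prefix _≡_ p v
prefix-of-prefix {p = p} {v} p-w v-w le with prefix⇒ p-w
... | a , refl with prefix⇒ v-w
... | a′ , eq with split p {v} (sym eq) le
... | d , refl , _ = prefix⇐ p d

-- An occurrence that starts inside `a` ends before `e` does, since `p` is no longer than `e`.
infix-split : {p : Word k} (a e : Word k) {t : Word k} → length p ≤ length e →
              Infix _≡_ p (a ++ e ++ t) → Infix _≡_ p (a ++ e) ⊎ Infix _≡_ p (e ++ t)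
infix-split []      e     le i         = inj₂ i
infix-split (x ∷ a) e     le (there i) = Sum.map₁ there (infix-split a e le i)
infix-split (x ∷ a) e {t} le (here q)  = inj₁ (here (prefix-of-prefix q
  (subst (Prefix _≡_ (x ∷ a ++ e)) (cong (x ∷_) (++-assoc a e t)) (prefix⇐ (x ∷ a ++ e) t)) bound))
  where
  bound = ≤-trans le (≤-trans (m≤n+m (length e) (length (x ∷ a)))
            (≤-reflexive (sym (length-++ (x ∷ a)))))

power : ℕ → Word k → Word k
power zero    w = []
power (suc n) w = w ++ power n w

power-comm : (n : ℕ) (w : Word k) → power n w ++ w ≡ w ++ power n w
power-comm zero    w = sym (++-identityʳ w)
power-comm (suc n) w = trans (++-assoc w (power n w) w) (cong (w ++_) (power-comm n w))

length-power : (n : ℕ) (w : Word k) → length (power n w) ≡ n * length w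
length-power zero    w = refl
length-power (suc n) w = trans (length-++ w) (cong (length w +_) (length-power n w))

-- A word no longer than one block cannot reach beyond the block after the one where it starts, so
-- only `c ++ e` and `e ++ e` need checking.
infix-power : {p e : Word k} → length p ≤ length e → ¬ Infix _≡_ p (e ++ e) →
              ∀ (c : Word k) n → ¬ Infix _≡_ p (c ++ e) → ¬ Infix _≡_ p (c ++ power (suc n) e)
infix-power {e = e} le ¬ee c n ¬ce i with infix-split c e le i
... | inj₁ j = ¬ce j
infix-power {e = e} le ¬ee c zero    ¬ce i | inj₂ j =
  -- Only one block is left; an occurrence in it is also one in `e ++ e`.
  ¬ee (subst (Infix _≡_ _) (++-identityʳ e) j ⁱ++ e)
infix-power {e = e} le ¬ee c (suc n) ¬ce i | inj₂ j = infix-power le ¬ee e n ¬ee j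

suffix-of-suffix : {v e w : Word k} → Suffix _≡_ v w → Suffix _≡_ e w → length v ≤ length e →
                   Suffix _≡_ v e
suffix-of-suffix {v = v} {e} v-w e-w le with suffix⇒ v-w
... | b , refl with suffix⇒ e-w
... | b′ , eq with split b′ {b} eq (+-cancelʳ-≤ (length v) (length b′) (length b) bound)
  where
  open ≤-Reasoning
  bound : length b′ + length v ≤ length b + length v
  bound = begin
    length b′ + length v ≤⟨ +-monoʳ-≤ (length b′) le ⟩
    length b′ + length e ≡⟨ length-++ b′ ⟨
    length (b′ ++ e)     ≡⟨ cong length eq ⟨
    length (b ++ v)      ≡⟨ length-++ b ⟩
    length b + length v  ∎
... | d , _ , refl = suffix⇐ d v

prefix-suffix⇒infix : {p v s : Word k} → Prefix _≡_ p v → Suffix _≡_ v s → Infix _≡_ p s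
prefix-suffix⇒infix {p = p} pre suf with prefix⇒ pre
... | a , refl with suffix⇒ suf
... | b , refl = fromView (MkView b (≡⇒Pointwise-≡ refl) a)

-- `s` makes up at least half of the word, so the final copy of `v` lies inside it.
half-suffix : {v b s : Word k} → length b ≤ length s → NonOverlappingBorder v (b ++ s) → Suffix _≡_ v s
half-suffix {v = v} {b} {s} le ((_ , _ , (suf , _)) , 2v≤) =
  suffix-of-suffix suf (suffix⇐ b s) (*-cancelˡ-≤ 2 (begin
    2 * length v          ≤⟨ 2v≤ ⟩
    length (b ++ s)       ≡⟨ length-++ b ⟩
    length b + length s   ≤⟨ +-monoˡ-≤ (length s) le ⟩
    length s + length s   ≡⟨ cong (length s +_) (+-identityʳ _) ⟨
    2 * length s          ∎))
  where open ≤-Reasoning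

-- A border at least as long as `p` would begin with `p`, and its final copy would place `p` inside
-- `s`. The surviving candidates are prefixes of the fixed word `p`, a finite check against the
-- ending `e`.
short-border : {p e v w : Word k} (b s : Word k) → w ≡ b ++ s → length b ≤ length s →
               ¬ Infix _≡_ p s → Prefix _≡_ p w → Suffix _≡_ e w → length p ≤ length e →
               NonOverlappingBorder v w → Prefix _≡_ v p × Suffix _≡_ v e
short-border {p = p} {v = v} b s refl le ¬ps p-w e-w p≤e N@((_ , (v-w , _) , (w-v , _)) , _)
  with length p ≤? length v
... | yes p≤v = ⊥-elim (¬ps (prefix-suffix⇒infix (prefix-of-prefix p-w v-w p≤v) (half-suffix le N)))
... | no p≰v  = prefix-of-prefix v-w p-w (<⇒≤ v<p)
              , suffix-of-suffix w-v e-w (≤-trans (<⇒≤ v<p) p≤e)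
  where v<p = ≰⇒> p≰v

-- The extremal words

pattern 0₂ = zero
pattern 1₂ = suc zero

¬infix : {p s : Word k} → {t : False (infix? Fin._≟_ p s)} → ¬ Infix _≡_ p s
¬infix {t = t} = toWitnessFalse t

¬suffix : {v s : Word k} → {t : False (suffix? Fin._≟_ v s)} → ¬ Suffix _≡_ v s
¬suffix {t = t} = toWitnessFalse t

-- The two sides of one layer: the factors 0, 1, 01 spell 0·1·01 on the left and 01·1·0 on the
-- right.
leftBlock rightBlock : Word 2
leftBlock  = 0₂ ∷ 1₂ ∷ 0₂ ∷ 1₂ ∷ []
rightBlock = 0₂ ∷ 1₂ ∷ 1₂ ∷ 0₂ ∷ []

layer : List (Word 2)
layer = [ 0₂ ] ∷ [ 1₂ ] ∷ (0₂ ∷ 1₂ ∷ []) ∷ []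

-- (0101)^l c (0110)^l
extremal : Word 2 → ℕ → Word 2
extremal c zero    = c
extremal c (suc l) = assemble layer (extremal c l)

-- The centre is cut in two because only its right part has to avoid 0101 and 1010.
-- The case of one layer is separate: there the words left after peeling 0 and 0, 1 need not
-- start with 1010 or 0101.
record Centre (c : Word 2) : Set where
  constructor centre-of
  field
    left right : Word 2
    cut        : c ≡ left ++ right
    left≤right : length left ≤ length right
    no-0101    : ¬ Infix _≡_ leftBlock (right ++ rightBlock)
    no-1010    : ¬ Infix _≡_ (1₂ ∷ 0₂ ∷ 1₂ ∷ 0₂ ∷ []) (right ++ rightBlock)
    one-layer  : width (extremal c 1) ≡ 6 + width c

layer-++ : (w : Word 2) → assemble layer w ≡ leftBlock ++ w ++ rightBlock
layer-++ w = cong (λ x → 0₂ ∷ 1₂ ∷ 0₂ ∷ 1₂ ∷ x)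
  (trans (cong (_++ [ 0₂ ]) (++-assoc w (0₂ ∷ 1₂ ∷ []) [ 1₂ ]))
         (++-assoc w (0₂ ∷ 1₂ ∷ 1₂ ∷ []) [ 0₂ ]))

-- Passes from nested layers, suited to peeling, to powers of blocks, suited to `infix-power`.
extremal-++ : (c : Word 2) (l : ℕ) → extremal c l ≡ power l leftBlock ++ c ++ power l rightBlock
extremal-++ c zero    = sym (++-identityʳ c)
extremal-++ c (suc l) = begin
  assemble layer (extremal c l)                             ≡⟨ layer-++ (extremal c l) ⟩
  leftBlock ++ extremal c l ++ rightBlock                   ≡⟨ cong (λ x → leftBlock ++ x ++ rightBlock) (extremal-++ c l) ⟩
  leftBlock ++ (L ++ c ++ R) ++ rightBlock                  ≡⟨ cong (leftBlock ++_) (++-assoc L (c ++ R) rightBlock) ⟩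
  leftBlock ++ L ++ (c ++ R) ++ rightBlock                  ≡⟨ cong (λ x → leftBlock ++ L ++ x) (++-assoc c R rightBlock) ⟩
  leftBlock ++ L ++ c ++ (R ++ rightBlock)                  ≡⟨ cong (λ x → leftBlock ++ L ++ c ++ x) (power-comm l rightBlock) ⟩
  leftBlock ++ L ++ c ++ rightBlock ++ R                    ∎
  where
  open ≡-Reasoning
  L = power l leftBlock
  R = power l rightBlock

length-extremal : (c : Word 2) (l : ℕ) → length (extremal c l) ≡ 8 * l + length c
length-extremal c l = begin
  length (extremal c l)                             ≡⟨ cong length (extremal-++ c l) ⟩
  length (power l leftBlock ++ c ++ power l rightBlock) ≡⟨ length-++ (power l leftBlock) ⟩
  length (power l leftBlock) + length (c ++ power l rightBlock)
    ≡⟨ cong (length (power l leftBlock) +_) (length-++ c) ⟩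
  length (power l leftBlock) + (length c + length (power l rightBlock))
    ≡⟨ cong₂ (λ x y → x + (length c + y)) (length-power l leftBlock) (length-power l rightBlock) ⟩
  l * 4 + (length c + l * 4)                        ≡⟨ lemma l (length c) ⟩
  8 * l + length c                                  ∎
  where
  open ≡-Reasoning
  lemma : ∀ l m → l * 4 + (m + l * 4) ≡ 8 * l + m
  lemma = solve-∀

-- Peeling one layer around a word that still has a layer

module _ {c : Word 2} (C : Centre c) (l : ℕ) where
  open Centre C

  private
    inner : Word 2
    inner = extremal c (suc l)

    leftHalf rightHalf : Word 2
    leftHalf  = power (suc l) leftBlock ++ left
    rightHalf = right ++ power (suc l) rightBlock

    inner-halves : inner ≡ leftHalf ++ rightHalf
    inner-halves = begin
      inner                        ≡⟨ extremal-++ c (suc l) ⟩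
      L ++ c ++ R                  ≡⟨ cong (λ x → L ++ x ++ R) cut ⟩
      L ++ (left ++ right) ++ R    ≡⟨ cong (L ++_) (++-assoc left right R) ⟩
      L ++ left ++ right ++ R      ≡⟨ ++-assoc L left (right ++ R) ⟨
      leftHalf ++ rightHalf        ∎
      where
      open ≡-Reasoning
      L = power (suc l) leftBlock
      R = power (suc l) rightBlock

    halves-≤ : length leftHalf ≤ length rightHalf
    halves-≤ = begin
      length leftHalf                                    ≡⟨ length-++ (power (suc l) leftBlock) ⟩
      length (power (suc l) leftBlock) + length left     ≤⟨ +-monoʳ-≤ (length (power (suc l) leftBlock)) left≤right ⟩
      length (power (suc l) leftBlock) + length right    ≡⟨ +-comm _ (length right) ⟩
      length right + length (power (suc l) leftBlock)    ≡⟨ cong (length right +_)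
        (trans (length-power (suc l) leftBlock) (sym (length-power (suc l) rightBlock))) ⟩
      length right + length (power (suc l) rightBlock)   ≡⟨ length-++ right ⟨
      length rightHalf                                   ∎
      where open ≤-Reasoning

    -- `s` is the right half followed by part of a further block, and `y` is the rest of that block.
    -- Completing it gives `right` followed by a power of `rightBlock`, where `infix-power` applies.
    rightHalf-avoids : {p : Word 2} (y : Word 2) → length p ≤ 4 →
                       ¬ Infix _≡_ p (rightBlock ++ rightBlock) → ¬ Infix _≡_ p (right ++ rightBlock) →
                       ∀ s → s ++ y ≡ rightHalf ++ rightBlock → ¬ Infix _≡_ p s
    rightHalf-avoids {p} y le ¬rr ¬r s eq i = infix-power le ¬rr right (suc l) ¬r
      (subst (Infix _≡_ p) (begin
        s ++ y                                             ≡⟨ eq ⟩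
        rightHalf ++ rightBlock                            ≡⟨ ++-assoc right (power (suc l) rightBlock) rightBlock ⟩
        right ++ power (suc l) rightBlock ++ rightBlock    ≡⟨ cong (right ++_) (power-comm (suc l) rightBlock) ⟩
        right ++ power (suc (suc l)) rightBlock            ∎)
      (i ⁱ++ y))
      where open ≡-Reasoning

    ends-in-rightBlock : (x y : Word 2) → Suffix _≡_ (rightBlock ++ y) (x ++ inner ++ y)
    ends-in-rightBlock x y = subst (Suffix _≡_ (rightBlock ++ y)) eq
                               (suffix⇐ (x ++ leftBlock ++ w) (rightBlock ++ y))
      where
      w = extremal c l
      open ≡-Reasoning
      eq : (x ++ leftBlock ++ w) ++ rightBlock ++ y ≡ x ++ inner ++ y
      eq = begin
        (x ++ leftBlock ++ w) ++ rightBlock ++ y   ≡⟨ ++-assoc x (leftBlock ++ w) (rightBlock ++ y) ⟩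
        x ++ leftBlock ++ w ++ rightBlock ++ y     ≡⟨ cong (λ v → x ++ leftBlock ++ v) (++-assoc w rightBlock y) ⟨
        x ++ (leftBlock ++ w ++ rightBlock) ++ y   ≡⟨ cong (λ v → x ++ v ++ y) (layer-++ w) ⟨
        x ++ inner ++ y                            ∎

    -- x and y are the parts of the outermost layer, at the left and the right, not yet peeled.
    longest-in-layer : {u : Word 2} (m x y z p : Word 2) → u ≢ [] → u ++ m ++ u ≡ x ++ inner ++ y →
                       length x ≤ length y → y ++ z ≡ rightBlock → length p ≤ 4 →
                       ¬ Infix _≡_ p (rightBlock ++ rightBlock) → ¬ Infix _≡_ p (right ++ rightBlock) →
                       Prefix _≡_ p (x ++ inner ++ y) →
                       (∀ v → Prefix _≡_ v p → Suffix _≡_ v (rightBlock ++ y) → length v ≤ length u) →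
                       LongestNonOverlappingBorder u (u ++ m ++ u)
    longest-in-layer {u} m x y z p u≢[] eq x≤y yz p≤4 ¬rr ¬r pre bound = flank-border m u≢[] , λ v M →
      let v-p , v-e = short-border (x ++ leftHalf) (rightHalf ++ y) halves le avoid pre
                        (ends-in-rightBlock x y) (≤-trans p≤4 (m≤m+n 4 (length y)))
                        (subst (NonOverlappingBorder v) eq M)
      in bound v v-p v-e
      where
      halves : x ++ inner ++ y ≡ (x ++ leftHalf) ++ rightHalf ++ y
      halves = begin
        x ++ inner ++ y                       ≡⟨ cong (λ w → x ++ w ++ y) inner-halves ⟩
        x ++ (leftHalf ++ rightHalf) ++ y     ≡⟨ cong (x ++_) (++-assoc leftHalf rightHalf y) ⟩
        x ++ leftHalf ++ rightHalf ++ y       ≡⟨ ++-assoc x leftHalf (rightHalf ++ y) ⟨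
        (x ++ leftHalf) ++ rightHalf ++ y     ∎
        where open ≡-Reasoning
      le : length (x ++ leftHalf) ≤ length (rightHalf ++ y)
      le = begin
        length (x ++ leftHalf)        ≡⟨ length-++ x ⟩
        length x + length leftHalf    ≤⟨ +-mono-≤ x≤y halves-≤ ⟩
        length y + length rightHalf   ≡⟨ +-comm (length y) _ ⟩
        length rightHalf + length y   ≡⟨ length-++ rightHalf ⟨
        length (rightHalf ++ y)       ∎
        where open ≤-Reasoning
      avoid : ¬ Infix _≡_ p (rightHalf ++ y)
      avoid = rightHalf-avoids z p≤4 ¬rr ¬r (rightHalf ++ y)
        (trans (++-assoc rightHalf y z) (cong (rightHalf ++_) yz))

    inner₁ inner₂ : Word 2
    inner₁ = assemble ((0₂ ∷ 1₂ ∷ []) ∷ []) inner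
    inner₂ = assemble ([ 1₂ ] ∷ (0₂ ∷ 1₂ ∷ []) ∷ []) inner

    -- The word starts with 0101 and ends with 011001; neither 010 nor 0101 is a suffix.
    longest-01 : LongestNonOverlappingBorder (0₂ ∷ 1₂ ∷ []) inner₁
    longest-01 = longest-in-layer inner (0₂ ∷ 1₂ ∷ []) (0₂ ∷ 1₂ ∷ []) (1₂ ∷ 0₂ ∷ []) leftBlock
      (λ ()) refl ≤-refl refl ≤-refl
      ¬infix no-0101 (refl ∷ refl ∷ refl ∷ refl ∷ [])
      λ where
        _ []                               _ → z≤n
        _ (refl ∷ [])                      _ → s≤s z≤n
        _ (refl ∷ refl ∷ [])               _ → ≤-refl
        _ (refl ∷ refl ∷ refl ∷ [])        s → ⊥-elim (¬suffix s)
        _ (refl ∷ refl ∷ refl ∷ refl ∷ []) s → ⊥-elim (¬suffix s)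

    -- With the outer 0 gone the word starts with 1010, hence the appeal to `no-1010`; it ends with
    -- 0110011, which rules out 10, 101 and 1010.
    longest-1 : LongestNonOverlappingBorder [ 1₂ ] inner₂
    longest-1 = longest-in-layer inner₁ (1₂ ∷ 0₂ ∷ 1₂ ∷ []) (0₂ ∷ 1₂ ∷ 1₂ ∷ []) [ 0₂ ] (1₂ ∷ 0₂ ∷ 1₂ ∷ 0₂ ∷ [])
      (λ ()) (cong (λ w → 1₂ ∷ 0₂ ∷ 1₂ ∷ w) (++-assoc inner (0₂ ∷ 1₂ ∷ []) [ 1₂ ]))
      ≤-refl refl ≤-refl
      ¬infix no-1010 (refl ∷ refl ∷ refl ∷ refl ∷ [])
      λ where
        _ []                               _ → z≤n
        _ (refl ∷ [])                      _ → ≤-refl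
        _ (refl ∷ refl ∷ [])               s → ⊥-elim (¬suffix s)
        _ (refl ∷ refl ∷ refl ∷ [])        s → ⊥-elim (¬suffix s)
        _ (refl ∷ refl ∷ refl ∷ refl ∷ []) s → ⊥-elim (¬suffix s)

    -- The word ends with 01100110, which rules out 01, 010 and 0101.
    longest-0 : LongestNonOverlappingBorder [ 0₂ ] (assemble layer inner)
    longest-0 = longest-in-layer inner₂ leftBlock rightBlock [] leftBlock
      (λ ()) (layer-++ inner) ≤-refl refl ≤-refl
      ¬infix no-0101 (refl ∷ refl ∷ refl ∷ refl ∷ [])
      λ where
        _ []                               _ → z≤n
        _ (refl ∷ [])                      _ → ≤-refl
        _ (refl ∷ refl ∷ [])               s → ⊥-elim (¬suffix s)
        _ (refl ∷ refl ∷ refl ∷ [])        s → ⊥-elim (¬suffix s)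
        _ (refl ∷ refl ∷ refl ∷ refl ∷ []) s → ⊥-elim (¬suffix s)

  width-layer : width (extremal c (2 + l)) ≡ 6 + width (extremal c (1 + l))
  width-layer = begin
    width (assemble layer inner)   ≡⟨ width-peel {x = inner₂} longest-0 ⟩
    2 + width inner₂               ≡⟨ cong (2 +_) (width-peel {x = inner₁} longest-1) ⟩
    4 + width inner₁               ≡⟨ cong (4 +_) (width-peel {x = inner} longest-01) ⟩
    6 + width inner                ∎
    where open ≡-Reasoning

width-extremal : {c : Word 2} → Centre c → ∀ l → width (extremal c l) ≡ 6 * l + width c
width-extremal C zero          = refl
width-extremal C (suc zero)    = Centre.one-layer C
width-extremal {c} C (suc (suc l)) = begin
  width (extremal c (2 + l))      ≡⟨ width-layer C l ⟩
  6 + width (extremal c (1 + l))  ≡⟨ cong (6 +_) (width-extremal C (suc l)) ⟩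
  6 + (6 * suc l + width c)       ≡⟨ lemma l (width c) ⟩
  6 * (2 + l) + width c           ∎
  where
  open ≡-Reasoning
  lemma : ∀ l w → 6 + (6 * (1 + l) + w) ≡ 6 * (2 + l) + w
  lemma = solve-∀

-- Combining the two bounds

maxWidth-8* : ∀ l i → maxWidth (8 * l + i) ≡ 6 * l + maxWidth i
maxWidth-8* zero    i = refl
maxWidth-8* (suc l) i = begin
  maxWidth (8 * suc l + i)     ≡⟨ cong maxWidth (lemma₁ l i) ⟩
  6 + maxWidth (8 * l + i)     ≡⟨ cong (6 +_) (maxWidth-8* l i) ⟩
  6 + (6 * l + maxWidth i)     ≡⟨ lemma₂ l (maxWidth i) ⟩
  6 * suc l + maxWidth i       ∎
  where
  open ≡-Reasoning
  lemma₁ : ∀ l i → 8 * suc l + i ≡ 8 + (8 * l + i)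
  lemma₁ = solve-∀
  lemma₂ : ∀ l i → 6 + (6 * l + i) ≡ 6 * suc l + i
  lemma₂ = solve-∀

f-≤ : ∀ n → f 2 n ≤ maxWidth n
-- `z≤n` takes care of the base value 0 of `max`.
f-≤ n = max≤v⁺ z≤n (All.map⁺ (tabulate λ {w} w∈ →
  subst (λ m → width w ≤ maxWidth m) (∈-words⁻ n w∈) (width≤maxWidth w)))

width-≤-f : (w : Word k) → width w ≤ f k (length w)
width-≤-f w = v≤max⁺ 0 _ (inj₂ (Any.map ≤-reflexive (∈-map⁺ width (∈-words⁺ w))))

-- A centre attaining the bound for its own length yields words attaining it for every number of
-- layers.
f-centre : {c : Word 2} → Centre c → width c ≡ maxWidth (length c) →
           ∀ l → f 2 (8 * l + length c) ≡ 6 * l + maxWidth (length c)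
f-centre {c} C eq l = ≤-antisym
  (≤-trans (f-≤ (8 * l + length c)) (≤-reflexive (maxWidth-8* l (length c))))
  (begin
    6 * l + maxWidth (length c)        ≡⟨ cong (6 * l +_) eq ⟨
    6 * l + width c                    ≡⟨ width-extremal C l ⟨
    width (extremal c l)               ≤⟨ width-≤-f (extremal c l) ⟩
    f 2 (length (extremal c l))        ≡⟨ cong (f 2) (length-extremal c l) ⟩
    f 2 (8 * l + length c)             ∎)
  where open ≤-Reasoning

-- For closed words the implicit arguments are settled by running the decision procedures; only the
-- width equation is left to supply.
mkCentre : (left right : Word 2) → {True (length left ≤? length right)} →
         {False (infix? Fin._≟_ leftBlock (right ++ rightBlock))} →
         {False (infix? Fin._≟_ (1₂ ∷ 0₂ ∷ 1₂ ∷ 0₂ ∷ []) (right ++ rightBlock))} →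
         width (extremal (left ++ right) 1) ≡ 6 + width (left ++ right) → Centre (left ++ right)
mkCentre left right {le} {p} {q} =
  centre-of left right refl (toWitness le) (¬infix {t = p}) (¬infix {t = q})

theorem6 : (l : ℕ) →
    ((i : ℕ) → i ≤ 5 → f 2 (8 * l + i) ≡ 6 * l + i) × f 2 (8 * l + 6) ≡ 6 * l + 5 × f 2 (8 * l + 7) ≡ 6 * l + 5
theorem6 l = small , f-centre c₆ refl l , f-centre c₇ refl l
  where
  -- Centres of lengths 0 to 7 whose widths equal `maxWidth`, as evaluation confirms.
  c₀ = mkCentre [] [] refl
  c₁ = mkCentre [] (0₂ ∷ []) refl
  c₂ = mkCentre [] (0₂ ∷ 0₂ ∷ []) refl
  c₃ = mkCentre [] (0₂ ∷ 1₂ ∷ 0₂ ∷ []) refl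
  c₄ = mkCentre [] (0₂ ∷ 1₂ ∷ 1₂ ∷ 0₂ ∷ []) refl
  c₅ = mkCentre [] (0₂ ∷ 1₂ ∷ 1₂ ∷ 1₂ ∷ 0₂ ∷ []) refl
  -- 010110 itself begins with 0101, so it is cut in the middle: 110 followed by 0110 contains
  -- neither 0101 nor 1010.
  c₆ = mkCentre (0₂ ∷ 1₂ ∷ 0₂ ∷ []) (1₂ ∷ 1₂ ∷ 0₂ ∷ []) refl
  c₇ = mkCentre [] (0₂ ∷ 1₂ ∷ 0₂ ∷ 0₂ ∷ 1₂ ∷ 1₂ ∷ 0₂ ∷ []) refl

  small : (i : ℕ) → i ≤ 5 → f 2 (8 * l + i) ≡ 6 * l + i
  small 0 _ = f-centre c₀ refl l
  small 1 _ = f-centre c₁ refl l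
  small 2 _ = f-centre c₂ refl l
  small 3 _ = f-centre c₃ refl l
  small 4 _ = f-centre c₄ refl l
  small 5 _ = f-centre c₅ refl l
  small (suc (suc (suc (suc (suc (suc _)))))) (s≤s (s≤s (s≤s (s≤s (s≤s ())))))
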